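{- Let $\pi = \lambda \oplus \mu \oplus \rho$ where $\lambda$, $\mu$ and $\rho$ are all nonempty permutations. Then the class $\operatorname{Av}(\pi)$ is not deflatable.
   Context: A permutation $\alpha$ is contained in $\beta$ if $\beta$ has a subsequence in the same relative order as $\alpha$; a class is a set of permutations closed under taking contained permutations; $\operatorname{Av}(\pi)$ is the class of permutations not containing $\pi$. $\alpha\oplus\beta$ is the permutation consisting of a copy of $\alpha$ followed by a copy of $\beta$ whose entries are all larger than those of the copy of $\alpha$. An interval of a permutation is a set of entries whose positions and values each form a set of consecutive integers, the whole permutation not counting as an interval; a permutation is simple if all its intervals are single entries (so $1$, $12$, $21$ are simple). A class $\mathcal{C}$ is deflatable if there is a proper subclass $\mathcal{D}\subsetneq\mathcal{C}$ with $\mathcal{C}\subseteq\langle\mathcal{D}\rangle$, where the substitution closure $\langle\mathcal{D}\rangle$ is the largest class whose simple permutations are exactly those of $\mathcal{D}$; equivalently, $\mathcal{C}$ is not deflatable if and only if every permutation in $\mathcal{C}$ is contained in some simple permutation belonging to $\mathcal{C}$. -}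

module Defs where

open import Data.Nat using (ℕ; zero; suc; _+_; _≤_; _<_; _∸_)
open import Data.Fin using (Fin; toℕ; _↑ˡ_; _↑ʳ_)
open import Data.Product using (Σ; ∃; _×_; _,_)
open import Data.Sum using (_⊎_)
open import Relation.Nullary using (¬_)
open import Relation.Binary.PropositionalEquality using (_≡_)
open import Function.Definitions using (Injective)
open import Function.Bundles using (_⇔_)

-- A permutation of length n: an injective (hence bijective) map
-- from positions Fin n to values Fin n (one-line notation).
record Perm : Set where
  constructor perm
  field
    len : ℕ
    val : Fin len → Fin len
    inj : Injective _≡_ _≡_ val
open Perm public

_≼_ : Perm → Perm → Set
α ≼ β = Σ (Fin (len α) → Fin (len β)) λ e →
          (∀ i j → toℕ i < toℕ j → toℕ (e i) < toℕ (e j)) ×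
          (∀ i j → (toℕ (val α i) < toℕ (val α j)) ⇔ (toℕ (val β (e i)) < toℕ (val β (e j))))

PermSet : Set₁
PermSet = Perm → Set

IsClass : PermSet → Set
IsClass C = ∀ α β → α ≼ β → C β → C α

Av : Perm → PermSet
Av π σ = ¬ (π ≼ σ)

IsDirectSum : Perm → Perm → Perm → Set
IsDirectSum α β γ =
  Σ (len γ ≡ len α + len β) λ { _≡_.refl →
     (∀ (i : Fin (len α)) → val γ (i ↑ˡ len β) ≡ val α i ↑ˡ len β) ×
     (∀ (j : Fin (len β)) → val γ (len α ↑ʳ j) ≡ len α ↑ʳ val β j) }

-- Intervals: positions a..b (a ≤ b < n) whose values form a set of consecutive
-- integers, i.e. every value lying between two values of the block is itself
-- taken by a position in the block; the whole permutation is excluded.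
IsBlockInterval : (σ : Perm) → ℕ → ℕ → Set
IsBlockInterval σ a b =
  a ≤ b × b < len σ ×
  (∀ (i j p : Fin (len σ)) →
     a ≤ toℕ i → toℕ i ≤ b → a ≤ toℕ j → toℕ j ≤ b →
     toℕ (val σ i) ≤ toℕ (val σ p) → toℕ (val σ p) ≤ toℕ (val σ j) →
     a ≤ toℕ p × toℕ p ≤ b)

IsInterval : (σ : Perm) → ℕ → ℕ → Set
IsInterval σ a b = IsBlockInterval σ a b × ¬ (a ≡ 0 × suc b ≡ len σ)

Simple : Perm → Set
Simple σ = ∀ a b → IsInterval σ a b → a ≡ b

_⊆_ : PermSet → PermSet → Set
C ⊆ D = ∀ σ → C σ → D σ

-- Substitution closure ⟨D⟩: the largest class whose simple permutations are
-- exactly those of D; i.e. the union of all classes E whose simple members are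
-- exactly the simple members of D (this union is itself such a class).
SubstClosure : PermSet → Perm → Set₁
SubstClosure D σ =
  Σ PermSet λ E → IsClass E × (∀ s → Simple s → (E s ⇔ D s)) × E σ

Deflatable : PermSet → Set₁
Deflatable C =
  Σ PermSet λ D → IsClass D × D ⊆ C × (Σ Perm λ σ → C σ × ¬ D σ) ×
    (∀ σ → C σ → SubstClosure D σ)

-- A permutation is a finite set with two linear orders, and its intervals are the subsets convex in
-- both.  It suffices to embed every member of Av(λ ⊕ μ ⊕ ρ) in a simple member, which is done by
-- destroying its intervals one at a time, two-element intervals first.
-- If a copy of λ lies south-west of an interval J, cut J by a single point as low as the lowest
-- such copy permits; if a copy of ρ lies north-east of J, do the same after a half turn.  Otherwise
-- points close to J cannot take part in a copy of λ ⊕ μ ⊕ ρ, because μ is nonempty, and three such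
-- points suffice to cut J.  Once no two-element intervals are left and J is minimal, every new
-- interval containing a new point contains J, so the number of intervals decreases.
module Submission where

open import Defs
open import Level using (Level)
open import Data.Nat using (ℕ; zero; suc; _+_)
import Data.Nat as ℕ
import Data.Nat.Properties as ℕₚ
open import Data.Nat.Induction using (<-wellFounded)
open import Data.Bool using (true; false)
import Data.Bool.Properties as Boolₚ
open import Data.Fin as Fin using (Fin; zero; suc; _↑ˡ_; _↑ʳ_)
import Data.Fin.Properties as Finₚ
open import Data.Fin.Induction using (spo-wellFounded)
open import Data.Fin.Subset as Subset using (Subset; _∈_; _∉_; _⊂_; _∩_; ∁; ∣_∣)
  renaming (_⊆_ to _⊆ˢ_)
open import Data.Fin.Subset.Properties using
  (_∈?_; _⊆?_; p⊂q⇒∣p∣<∣q∣; x∈p∩q⁺; x∈p∩q⁻; p∩q⊆p; x∉p⇒x∈∁p; x∈∁p⇒x∉p;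
   ⊆-antisym; ⊆-max; Empty-unique; ∈⊤; ∣⊤∣≡n)
open import Data.List as List using (List; []; _∷_; length)
import Data.List.Properties as Listₚ
open import Data.List.Membership.Propositional using () renaming (_∈_ to _∈ˡ_)
open import Data.List.Membership.Propositional.Properties
  using (∈-map⁺; ∈-filter⁺; ∈-++⁺ˡ; ∈-++⁺ʳ)
open import Data.List.Relation.Unary.Any using (here)
import Data.List.Relation.Unary.Any as Any
open import Data.Vec as Vec using ([]; _∷_; _++_; replicate)
import Data.Vec.Properties as Vecₚ
open import Data.Product using (Σ; ∃; _×_; _,_; proj₁; proj₂)
open import Data.Sum using (_⊎_; inj₁; inj₂)
import Data.Sum as Sum
open import Data.Empty using (⊥; ⊥-elim)
open import Data.Unit using (⊤; tt)
open import Function using (_∘_; id; flip; case_of_)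
open import Function.Bundles using (Equivalence; mk⇔)
open import Induction.WellFounded using (Acc; acc)
open import Relation.Nullary using (¬_; Dec; yes; no; does; contradiction; ¬?)
open import Relation.Nullary.Decidable using (dec-true; dec-false; _×-dec_)
open import Relation.Binary using (IsStrictPartialOrder; tri<; tri≈; tri>)
open import Relation.Binary.PropositionalEquality
  using (_≡_; _≢_; refl; sym; trans; cong; subst; isEquivalence; resp₂)

private variable
  ℓ : Level
  k l m n o : ℕ

-- Linear orders and their convex subsets.

record Lin (n : ℕ) : Set₁ where
  infix 4 _≺_ _⪯_
  field
    _≺_    : Fin n → Fin n → Set
    ≺-irr   : ∀ {a} → ¬ a ≺ a
    ≺-trans : ∀ {a b c} → a ≺ b → b ≺ c → a ≺ c
    ≺-cmp   : ∀ a b → a ≺ b ⊎ a ≡ b ⊎ b ≺ a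

  _⪯_ : Fin n → Fin n → Set
  a ⪯ b = a ≡ b ⊎ a ≺ b

  ≺-⪯-trans : ∀ {a b c} → a ≺ b → b ⪯ c → a ≺ c
  ≺-⪯-trans p (inj₁ refl) = p
  ≺-⪯-trans p (inj₂ q)    = ≺-trans p q

  ⪯-≺-trans : ∀ {a b c} → a ⪯ b → b ≺ c → a ≺ c
  ⪯-≺-trans (inj₁ refl) q = q
  ⪯-≺-trans (inj₂ p)    q = ≺-trans p q

  ≺⇒≢ : ∀ {a b} → a ≺ b → a ≢ b
  ≺⇒≢ p refl = ≺-irr p

  ≺-asym : ∀ {a b} → a ≺ b → ¬ b ≺ a
  ≺-asym p q = ≺-irr (≺-trans p q)

  ⊀⇒⪰ : ∀ {a b} → ¬ a ≺ b → b ⪯ a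
  ⊀⇒⪰ {a} {b} q with ≺-cmp a b
  ... | inj₁ p        = contradiction p q
  ... | inj₂ (inj₁ p) = inj₁ (sym p)
  ... | inj₂ (inj₂ p) = inj₂ p

  ⪯∧≢⇒≺ : ∀ {a b} → a ⪯ b → a ≢ b → a ≺ b
  ⪯∧≢⇒≺ (inj₁ p) q = contradiction p q
  ⪯∧≢⇒≺ (inj₂ p) q = p

  ≺-dec : ∀ a b → a ≺ b ⊎ b ⪯ a
  ≺-dec a b with ≺-cmp a b
  ... | inj₁ p        = inj₁ p
  ... | inj₂ (inj₁ p) = inj₂ (inj₁ (sym p))
  ... | inj₂ (inj₂ p) = inj₂ (inj₂ p)

  ≺-isStrictPartialOrder : IsStrictPartialOrder _≡_ _≺_
  ≺-isStrictPartialOrder = record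
    { isEquivalence = isEquivalence
    ; irrefl        = λ { refl → ≺-irr }
    ; trans         = ≺-trans
    ; <-resp-≈      = resp₂ _≺_
    }

op : Lin n → Lin n
op L = record
  { _≺_     = flip _≺_
  ; ≺-irr   = ≺-irr
  ; ≺-trans = flip ≺-trans
  ; ≺-cmp   = λ a b → ≺-cmp-op a b
  } where
  open Lin L
  ≺-cmp-op : ∀ a b → b ≺ a ⊎ a ≡ b ⊎ a ≺ b
  ≺-cmp-op a b with ≺-cmp a b
  ... | inj₁ p        = inj₂ (inj₂ p)
  ... | inj₂ (inj₁ p) = inj₂ (inj₁ p)
  ... | inj₂ (inj₂ p) = inj₁ p

-- The theorem is a negation, so the argument can aim at `⊥` throughout. This permits case
-- distinctions and least elements for predicates given without a decision procedure.
em : {A : Set ℓ} → (A ⊎ ¬ A → ⊥) → ⊥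
em k = k (inj₂ (k ∘ inj₁))

module _ (L : Lin n) where
  open Lin L

  least : (P : Fin n → Set) → ∃ P →
          (∀ a → P a → (∀ b → P b → a ⪯ b) → ⊥) → ⊥
  least P (a , pa) k = go a (spo-wellFounded ≺-isStrictPartialOrder a) pa
    where
    go : ∀ a → Acc _≺_ a → P a → ⊥
    go a (acc rs) pa = k a pa λ b pb → ⊀⇒⪰ λ b≺a → go b (rs b≺a) pb

  Convex : Subset n → Set
  Convex S = ∀ {a b c} → a ∈ S → c ∈ S → a ≺ b → b ≺ c → b ∈ S

module _ (L : Lin n) {S : Subset n} (convex : Convex L S) where
  open Lin L

  below-convex : ∀ {a i j} → a ∉ S → i ∈ S → j ∈ S → a ≺ i → a ≺ j
  below-convex {a} {i} {j} a∉ i∈ j∈ p with ≺-cmp a j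
  ... | inj₁ q           = q
  ... | inj₂ (inj₁ refl) = contradiction j∈ a∉
  ... | inj₂ (inj₂ q)    = contradiction (convex j∈ i∈ q p) a∉

  above-convex : ∀ {a i j} → a ∉ S → i ∈ S → j ∈ S → i ≺ a → j ≺ a
  above-convex {a} {i} {j} a∉ i∈ j∈ p with ≺-cmp j a
  ... | inj₁ q           = q
  ... | inj₂ (inj₁ refl) = contradiction j∈ a∉
  ... | inj₂ (inj₂ q)    = contradiction (convex i∈ j∈ p q) a∉

  convex-∩ : ∀ {T} → Convex L T → Convex L (S ∩ T)
  convex-∩ {T} convex′ a∈ c∈ p q =
    let a∈S , a∈T = x∈p∩q⁻ S T a∈ ; c∈S , c∈T = x∈p∩q⁻ S T c∈ in
    x∈p∩q⁺ (convex a∈S c∈S p q , convex′ a∈T c∈T p q)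

-- If some `b` in `T` lay between two points of `S` outside `T`, these would have all of `T` on the
-- same sides as `b`. Then `e` would lie between them too, and belong to `S`.
convex-∖ : (L : Lin n) {S T : Subset n} → Convex L S → Convex L T →
           ∀ {e} → e ∈ T → e ∉ S → Convex L (S ∩ ∁ T)
convex-∖ L {S} {T} cS cT e∈T e∉S a∈ c∈ p q =
  let a∈S , a∈∁ = x∈p∩q⁻ S (∁ T) a∈ ; c∈S , c∈∁ = x∈p∩q⁻ S (∁ T) c∈ in
  x∈p∩q⁺ (cS a∈S c∈S p q , x∉p⇒x∈∁p λ b∈T →
    e∉S (cS a∈S c∈S (below-convex L cT (x∈∁p⇒x∉p a∈∁) b∈T e∈T p)
                    (above-convex L cT (x∈∁p⇒x∉p c∈∁) b∈T e∈T q)))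

-- Insertion of a point into a linear order.

-- D and U are the elements below and above the new element zero.
module _ (L : Lin n) (D U : Fin n → Set) (part : ∀ a → D a ⊎ U a)
         (sep : ∀ {a b} → D a → U b → Lin._≺_ L a b)
         (down : ∀ {a b} → Lin._≺_ L a b → D b → D a)
         (up : ∀ {a b} → Lin._≺_ L a b → U a → U b) where
  open Lin L

  InsertRel : Fin (suc n) → Fin (suc n) → Set
  InsertRel zero    zero    = ⊥
  InsertRel zero    (suc b) = U b
  InsertRel (suc a) zero    = D a
  InsertRel (suc a) (suc b) = a ≺ b

  insert : Lin (suc n)
  insert = record
    { _≺_     = InsertRel
    ; ≺-irr   = λ {a} → irr a
    ; ≺-trans = λ {a} {b} {c} → tra a b c
    ; ≺-cmp   = compare
    } where
    irr : ∀ a → ¬ InsertRel a a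
    irr (suc a) = ≺-irr
    tra : ∀ a b c → InsertRel a b → InsertRel b c → InsertRel a c
    tra zero    (suc b) zero    p q = ≺-irr (sep q p)
    tra zero    (suc b) (suc c) p q = up q p
    tra (suc a) zero    (suc c) p q = sep p q
    tra (suc a) (suc b) zero    p q = down p q
    tra (suc a) (suc b) (suc c) p q = ≺-trans p q
    compare : ∀ a b → InsertRel a b ⊎ a ≡ b ⊎ InsertRel b a
    compare zero    zero    = inj₂ (inj₁ refl)
    compare zero    (suc b) = Sum.map id inj₂ (Sum.swap (part b))
    compare (suc a) zero    = Sum.map id inj₂ (part a)
    compare (suc a) (suc b) = Sum.map id (Sum.map (cong suc) id) (≺-cmp a b)

-- The cut is right next to `e`: every other old element compares with the new point as it does with
-- `e`.
insertBelow insertAbove : Lin n → Fin n → Lin (suc n)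
insertBelow L e = insert L (_≺ e) (e ⪯_) (λ a → ≺-dec a e) ≺-⪯-trans ≺-trans
  (λ p q → inj₂ (⪯-≺-trans q p))
  where open Lin L
insertAbove L e = insert L (_⪯ e) (e ≺_) (λ a → Sum.swap (≺-dec e a)) ⪯-≺-trans
  (λ p q → inj₂ (≺-⪯-trans p q)) (flip ≺-trans)
  where open Lin L

-- Configurations: point sets with two linear orders.

-- Abstract orders spare the renumbering of positions and values on insertion: an old point only
-- gains a `suc`.
record Conf (n : ℕ) : Set₁ where
  constructor _,_
  field
    X Y : Lin n
  open Lin X public hiding (≺-isStrictPartialOrder) renaming
    ( _≺_ to _<ˣ_; _⪯_ to _≤ˣ_; ≺-irr to irrˣ; ≺-trans to transˣ; ≺-cmp to cmpˣ
    ; ≺-⪯-trans to <-≤-transˣ; ⪯-≺-trans to ≤-<-transˣ; ≺-dec to decˣ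
    ; ≺-asym to asymˣ; ⊀⇒⪰ to ≮⇒≥ˣ; ⪯∧≢⇒≺ to ≤∧≢⇒<ˣ; ≺⇒≢ to <⇒≢ˣ)
  open Lin Y public hiding (≺-isStrictPartialOrder) renaming
    ( _≺_ to _<ʸ_; _⪯_ to _≤ʸ_; ≺-irr to irrʸ; ≺-trans to transʸ; ≺-cmp to cmpʸ
    ; ≺-⪯-trans to <-≤-transʸ; ⪯-≺-trans to ≤-<-transʸ; ≺-dec to decʸ
    ; ≺-asym to asymʸ; ⊀⇒⪰ to ≮⇒≥ʸ; ⪯∧≢⇒≺ to ≤∧≢⇒<ʸ; ≺⇒≢ to <⇒≢ʸ)

  Block : Subset n → Set
  Block S = Convex X S × Convex Y S

  infix 4 _↗_
  _↗_ : Fin n → Fin n → Set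
  a ↗ b = a <ˣ b × a <ʸ b

  ↗-trans : ∀ {a b c} → a ↗ b → b ↗ c → a ↗ c
  ↗-trans (p , p′) (q , q′) = transˣ p q , transʸ p′ q′

reverse : Conf n → Conf n
reverse (X , Y) = op X , op Y

-- By trichotomy, a map that preserves both orders also reflects them and is injective.
record Emb (P : Conf k) (C : Conf n) : Set where
  private
    module P = Conf P
    module C = Conf C
  field
    pt    : Fin k → Fin n
    monoˣ : ∀ {i j} → i P.<ˣ j → pt i C.<ˣ pt j
    monoʸ : ∀ {i j} → i P.<ʸ j → pt i C.<ʸ pt j
open Emb

_∘ᵉ_ : {A : Conf k} {B : Conf m} {C : Conf n} → Emb B C → Emb A B → Emb A C
f ∘ᵉ e = record
  { pt = pt f ∘ pt e ; monoˣ = monoˣ f ∘ monoˣ e ; monoʸ = monoʸ f ∘ monoʸ e }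

reverseᵉ : {P : Conf k} {C : Conf n} → Emb P C → Emb (reverse P) (reverse C)
reverseᵉ e = record { pt = pt e ; monoˣ = monoˣ e ; monoʸ = monoʸ e }

unreverseᵉ : {P : Conf k} {C : Conf n} → Emb (reverse P) (reverse C) → Emb P C
unreverseᵉ e = record { pt = pt e ; monoˣ = monoˣ e ; monoʸ = monoʸ e }

-- Avoidance, and extensions that destroy a block.

module _ (Λ : Conf k) (M : Conf l) (P : Conf m) where

  -- Avoidance of the direct sum of the three without building it. For nonempty `M`, the relation
  -- between `Λ` and `P` follows through any point of `M`.
  Avoids : Conf n → Set
  Avoids C = ∀ (e : Emb Λ C) (f : Emb M C) (g : Emb P C) →
    (∀ i j → pt e i ↗ pt f j) → (∀ i j → pt f i ↗ pt g j) → ⊥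
    where open Conf C

  -- The common interface of the two constructions. `splits` keeps `J` from surviving among the old
  -- points alone. `full` makes each larger block with a new point straddle the border of `J`; for a
  -- minimal `J` with more than two elements it then contains `J`.
  record Extension (C : Conf n) (J : Subset n) : Set₁ where
    field
      new    : ℕ
      conf   : Conf (new + n)
    private
      module C  = Conf C
      module C⁺ = Conf conf
    field
      oldˣ   : ∀ {a b} → a C.<ˣ b → (new ↑ʳ a) C⁺.<ˣ (new ↑ʳ b)
      oldʸ   : ∀ {a b} → a C.<ʸ b → (new ↑ʳ a) C⁺.<ʸ (new ↑ʳ b)
      avoids : Avoids conf
      f f₂ e : Fin n
      f∈J    : f ∈ J
      f₂∈J   : f₂ ∈ J
      e∉J    : e ∉ J
      splits : ∀ {I} → C⁺.Block I → new ↑ʳ f ∈ I → new ↑ʳ f₂ ∈ I → ∃ λ i → i ↑ˡ n ∈ I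
      full   : ∀ {I} → C⁺.Block I → ∀ i → i ↑ˡ n ∈ I → ∀ b → b ∈ I → b ≢ i ↑ˡ n →
               (∀ j → j ↑ˡ n ∈ I) × new ↑ʳ e ∈ I × new ↑ʳ f ∈ I

-- A half turn exchanges the two ends of the sum, so each construction is carried out on one side
-- only.
reverse-extension : {Λ : Conf k} {M : Conf l} {P : Conf m} {C : Conf n} {J : Subset n} →
  Extension (reverse P) (reverse M) (reverse Λ) (reverse C) J → Extension Λ M P C J
reverse-extension E = record
  { new    = new E
  ; conf   = reverse (conf E)
  ; oldˣ   = oldˣ E
  ; oldʸ   = oldʸ E
  ; avoids = λ e f g p q → avoids E (un g) (un f) (un e) (λ i j → q j i) (λ i j → p j i)
  ; f∈J    = f∈J E
  ; f₂∈J   = f₂∈J E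
  ; e∉J    = e∉J E
  ; splits = λ B → splits E (swapB {C = conf E} B)
  ; full   = λ B → full E (swapB {C = conf E} B)
  } where
  open Extension
  un : ∀ {k n} {P : Conf k} {C : Conf n} → Emb P (reverse C) → Emb (reverse P) C
  un e = record { pt = pt e ; monoˣ = monoˣ e ; monoʸ = monoʸ e }
  swapB : ∀ {n} {C : Conf n} {I} → Conf.Block (reverse C) I → Conf.Block C I
  swapB (cx , cy) = (λ a c p q → cx c a q p) , (λ a c p q → cy c a q p)

module _ (C : Conf n) where
  open Conf C

  record ProperBlock (J : Subset n) : Set where
    field
      isBlock : Block J
      {u v w} : Fin n
      u∈      : u ∈ J
      v∈      : v ∈ J
      u≢v     : u ≢ v
      w∉      : w ∉ J
  SW NE : Subset n → Fin n → Set
  SW J a = ∀ j → j ∈ J → a ↗ j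
  NE J a = ∀ j → j ∈ J → j ↗ a

  -- Any second element serves as `f₂`: a column just right of the leftmost `f` separates the two.
  leftmostPair : ∀ {J} → ProperBlock J →
    ((f f₂ : Fin n) → f ∈ J → (∀ b → b ∈ J → f ≤ˣ b) → f₂ ∈ J → f <ˣ f₂ → ⊥) → ⊥
  leftmostPair {J} B k = least X (_∈ J) (_ , u∈) λ f f∈ min → other f f∈ min (f Finₚ.≟ u)
    where
    open ProperBlock B
    other : ∀ f → f ∈ J → (∀ b → b ∈ J → f ≤ˣ b) → Dec (f ≡ u) → ⊥
    other f f∈ min (yes refl) = k f (v) f∈ min (v∈) (≤∧≢⇒<ˣ (min (v) (v∈)) (u≢v))
    other f f∈ min (no f≢u)   = k f (u) f∈ min (u∈) (≤∧≢⇒<ˣ (min (u) (u∈)) f≢u)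

-- Pulling copies back to the old points.

module _ {C : Conf n} {C⁺ : Conf (k + n)}
         (reflectˣ : ∀ {a b} → Conf._<ˣ_ C⁺ (k ↑ʳ a) (k ↑ʳ b) → Conf._<ˣ_ C a b)
         (reflectʸ : ∀ {a b} → Conf._<ʸ_ C⁺ (k ↑ʳ a) (k ↑ʳ b) → Conf._<ʸ_ C a b) where

  reflect-↗ : ∀ {p q a b} → p ≡ k ↑ʳ a → q ≡ k ↑ʳ b → Conf._↗_ C⁺ p q → Conf._↗_ C a b
  reflect-↗ refl refl (p , q) = reflectˣ p , reflectʸ q

  restrict : {Q : Conf m} {R : Fin n → Set} (g : Emb Q C⁺) →
    (∀ i → ∃ λ a → pt g i ≡ k ↑ʳ a × R a) → Emb Q C
  restrict g old = record
    { pt    = λ i → proj₁ (old i)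
    ; monoˣ = λ {i} {j} p → mx (proj₁ (proj₂ (old i))) (proj₁ (proj₂ (old j))) (monoˣ g p)
    ; monoʸ = λ {i} {j} p → my (proj₁ (proj₂ (old i))) (proj₁ (proj₂ (old j))) (monoʸ g p)
    } where
    mx : ∀ {p q a b} → p ≡ k ↑ʳ a → q ≡ k ↑ʳ b → Conf._<ˣ_ C⁺ p q → Conf._<ˣ_ C a b
    mx refl refl = reflectˣ
    my : ∀ {p q a b} → p ≡ k ↑ʳ a → q ≡ k ↑ʳ b → Conf._<ʸ_ C⁺ p q → Conf._<ʸ_ C a b
    my refl refl = reflectʸ

  avoids-old : {Λ : Conf l} {M : Conf m} {P : Conf o} → Avoids Λ M P C →
    (e : Emb Λ C⁺) (f : Emb M C⁺) (g : Emb P C⁺) →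
    {R S T : Fin n → Set} →
    (∀ i → ∃ λ a → pt e i ≡ k ↑ʳ a × R a) →
    (∀ i → ∃ λ a → pt f i ≡ k ↑ʳ a × S a) →
    (∀ i → ∃ λ a → pt g i ≡ k ↑ʳ a × T a) →
    (∀ i j → Conf._↗_ C⁺ (pt e i) (pt f j)) → (∀ i j → Conf._↗_ C⁺ (pt f i) (pt g j)) → ⊥
  avoids-old avoid e f g oe of og p q =
    avoid (restrict e oe) (restrict f of) (restrict g og)
      (λ i j → reflect-↗ (proj₁ (proj₂ (oe i))) (proj₁ (proj₂ (of j))) (p i j))
      (λ i j → reflect-↗ (proj₁ (proj₂ (of i))) (proj₁ (proj₂ (og j))) (q i j))

-- Cutting a block by one point.

-- The new point lies in the column of the leftmost pair of J, just below the top of a copy of Λ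
-- that is left of that column and has its top as low as possible.  In a copy of Λ ⊕ M ⊕ P
-- the new point could only play a part in Λ, and then the lowest copy could replace that part.
module _ {Λ : Conf k} {M : Conf l} {P : Conf m} (λ₀ : Fin k) (μ₀ : Fin l)
         {C : Conf n} (avoid : Avoids Λ M P C) {J : Subset n} (J-block : ProperBlock C J)
         (low : Emb Λ C) (low-SW : ∀ i → SW C J (pt low i)) where
  open Conf C

  extend-by-one : (Extension Λ M P C J → ⊥) → ⊥
  extend-by-one found =
    leftmostPair C J-block λ f f₂ f∈J f-min f₂∈J f<f₂ →
    -- Least in the opposite order: `τ` is the highest point of `Λ`.
    least (op (Conf.Y Λ)) (λ _ → ⊤) (λ₀ , tt) λ τ _ τ-max →
    least Y (λ b → Σ (Emb Λ C) λ ε → (∀ i → pt ε i ≤ˣ f) × b ≡ pt ε τ)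
      (_ , low , (λ i → inj₂ (proj₁ (low-SW i f f∈J))) , refl)
      λ { _ (ε , ε≤f , refl) ε-min →
        found (extension f f₂ f∈J f-min f₂∈J f<f₂ τ (λ i → τ-max i tt) ε ε≤f ε-min) }
    where
    module _ (f f₂ : Fin n) (f∈J : f ∈ J) (f-min : ∀ b → b ∈ J → f ≤ˣ b)
             (f₂∈J : f₂ ∈ J) (f<f₂ : f <ˣ f₂)
             (τ : Fin k) (τ-max : ∀ i → Lin._⪯_ (op (Conf.Y Λ)) τ i)
             (ε : Emb Λ C) (ε≤f : ∀ i → pt ε i ≤ˣ f)
             (ε-min : ∀ b → (Σ (Emb Λ C) λ ε′ → (∀ i → pt ε′ i ≤ˣ f) × b ≡ pt ε′ τ) →
                      pt ε τ ≤ʸ b)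
      where
      B : Block J
      B = ProperBlock.isBlock J-block

      e : Fin n
      e = pt ε τ

      C⁺ : Conf (suc n)
      C⁺ = insertAbove X f , insertBelow Y e
      module C⁺ = Conf C⁺

      e<ʸf : e <ʸ f
      e<ʸf = ≤-<-transʸ (ε-min _ (low , (λ i → inj₂ (proj₁ (low-SW i f f∈J))) , refl))
               (proj₂ (low-SW τ f f∈J))

      e<ˣf : e <ˣ f
      e<ˣf = ≤∧≢⇒<ˣ (ε≤f τ) (<⇒≢ʸ e<ʸf)

      e∉J : e ∉ J
      e∉J e∈J with f-min e e∈J
      ... | inj₁ e≡f = <⇒≢ˣ e<ˣf (sym e≡f)
      ... | inj₂ p   = asymˣ p e<ˣf

      ε≤e : ∀ i → pt ε i ≤ʸ e
      ε≤e i with τ-max i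
      ... | inj₁ refl = inj₁ refl
      ... | inj₂ p    = inj₂ (monoʸ ε p)

      above-new : ∀ q → zero C⁺.↗ q → ∃ λ a → q ≡ suc a × (f <ˣ a × e ≤ʸ a)
      above-new (suc a) p = a , refl , p

      below-new : ∀ q → q C⁺.↗ zero → ∃ λ a → q ≡ suc a × (a ≤ˣ f × a <ʸ e)
      below-new (suc a) p = a , refl , p

      old : ∀ {Q : Conf o} (g : Emb Q C⁺) → ¬ (∃ λ i → pt g i ≡ zero) →
            ∀ i → ∃ λ a → pt g i ≡ suc a × ⊤
      old g ≢0 i with pt g i in eq
      ... | zero  = contradiction (i , eq) ≢0
      ... | suc a = a , refl , tt

      -- Whatever is north-east of the new point is right of `f` and at least as high as `e`, but is
      -- not `e`, which is left of `f`. So it is north-east of all of `ε`, which can replace `d`.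
      new-in-Λ : (d : Emb Λ C⁺) (g : Emb M C⁺) (h : Emb P C⁺) → ∀ i → pt d i ≡ zero →
        (∀ i j → pt d i C⁺.↗ pt g j) → (∀ i j → pt g i C⁺.↗ pt h j) → ⊥
      new-in-Λ d g h i eq p q =
        avoid ε (restrict {C = C} {C⁺} id id g og) (restrict {C = C} {C⁺} id id h oh)
          (λ i j → let f<a , e≤a = proj₂ (proj₂ (og j)) in
             ≤-<-transˣ (ε≤f i) f<a ,
             ≤-<-transʸ (ε≤e i) (≤∧≢⇒<ʸ e≤a (<⇒≢ˣ (transˣ e<ˣf f<a))))
          (λ i j → reflect-↗ {C = C} {C⁺} id id
             (proj₁ (proj₂ (og i))) (proj₁ (proj₂ (oh j))) (q i j))
        where
        og : ∀ j → _
        og j = above-new (pt g j) (subst (C⁺._↗ pt g j) eq (p i j))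
        oh : ∀ j → _
        oh j = above-new (pt h j) (C⁺.↗-trans {zero} {pt g μ₀}
                 (subst (C⁺._↗ pt g μ₀) eq (p i μ₀)) (q μ₀ j))

      -- Such a copy would be weakly left of `f` with its top below `e`, against the choice of `ε`.
      new-above-Λ : (d : Emb Λ C⁺) → (∀ i → pt d i C⁺.↗ zero) → ⊥
      new-above-Λ d p = irrʸ (≤-<-transʸ
        (ε-min _ (restrict {C = C} {C⁺} id id d od , (λ i → proj₁ (proj₂ (proj₂ (od i)))) , refl))
        (proj₂ (proj₂ (proj₂ (od τ)))))
        where
        od : ∀ i → _
        od i = below-new (pt d i) (p i)

      C⁺-avoids : Avoids Λ M P C⁺
      C⁺-avoids d g h p q
        with Finₚ.any? (λ i → pt d i Finₚ.≟ zero) | Finₚ.any? (λ i → pt g i Finₚ.≟ zero)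
           | Finₚ.any? (λ i → pt h i Finₚ.≟ zero)
      ... | yes (i , eq) | _ | _ = new-in-Λ d g h i eq p q
      ... | no _ | yes (j , eq) | _ =
        new-above-Λ d λ i → subst (pt d i C⁺.↗_) eq (p i j)
      ... | no _ | no _ | yes (j , eq) =
        new-above-Λ d λ i → subst (pt d i C⁺.↗_) eq
          (C⁺.↗-trans {pt d i} {pt g μ₀} (p i μ₀) (q μ₀ j))
      ... | no ≢d | no ≢g | no ≢h =
        avoids-old {C = C} {C⁺} id id avoid d g h (old d ≢d) (old g ≢g) (old h ≢h) p q

      -- Horizontally the new point is between `f` and `f₂`. On the way to `a` the block passes one
      -- of them, or `a` is itself between them and so in `J`.
      meets-J : ∀ {I a} → C⁺.Block I → zero ∈ I → suc a ∈ I → ∃ λ j → j ∈ J × suc j ∈ I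
      meets-J {I} {a} (cx , _) z∈ a∈ with cmpˣ a f
      ... | inj₁ a<f          = f , f∈J , cx a∈ z∈ a<f (inj₁ refl)
      ... | inj₂ (inj₁ refl)  = f , f∈J , a∈
      ... | inj₂ (inj₂ f<a) with cmpˣ a f₂
      ...   | inj₁ a<f₂         = a , proj₁ B f∈J f₂∈J f<a a<f₂ , a∈
      ...   | inj₂ (inj₁ refl)  = f₂ , f₂∈J , a∈
      ...   | inj₂ (inj₂ f₂<a)  = f₂ , f₂∈J , cx z∈ a∈ f<f₂ f₂<a

      -- In height, `e` is between the new point and `J`; horizontally, `f` is between `e` and the
      -- new point.
      absorbs : ∀ {I a} → C⁺.Block I → zero ∈ I → suc a ∈ I → suc e ∈ I × suc f ∈ I
      absorbs blk z∈ a∈ with meets-J blk z∈ a∈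
      ... | j , j∈J , j∈ = e∈ , proj₁ blk e∈ z∈ e<ˣf (inj₁ refl)
        where
        e∈ = proj₂ blk z∈ j∈ (inj₁ refl) (below-convex Y (proj₂ B) e∉J f∈J j∈J e<ʸf)

      extension : Extension Λ M P C J
      extension = record
        { new = 1 ; conf = C⁺ ; oldˣ = id ; oldʸ = id ; avoids = C⁺-avoids
        ; f = f ; f₂ = f₂ ; e = e ; f∈J = f∈J ; f₂∈J = f₂∈J ; e∉J = e∉J
        ; splits = λ blk f∈ f₂∈ → zero , proj₁ blk f∈ f₂∈ (inj₁ refl) f<f₂
        ; full = λ { blk zero z∈ zero    b∈ b≢ → contradiction refl b≢
                   ; blk zero z∈ (suc a) b∈ _  → (λ { zero → z∈ }) , absorbs blk z∈ b∈ }
        }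

-- Cutting a block by three points.

-- Here no copy of Λ lies south-west of J and no copy of P lies north-east of J.  With f the
-- leftmost element of J and g the lowest element above J, the new points are
--   t  just right of f and just below g,
--   s  just left of f and just below t,
--   r  just right of s and just above g.
-- They are too close to J to take part in a copy of Λ ⊕ M ⊕ P; t cuts J, s cuts t from J,
-- r cuts s from t, and g cuts r from the rest.
module _ {Λ : Conf k} {M : Conf l} {P : Conf m} (μ₀ : Fin l)
         {C : Conf n} (avoid : Avoids Λ M P C) {J : Subset n} (J-block : ProperBlock C J)
         (no-SW : (d : Emb Λ C) → ¬ (∀ i → SW C J (pt d i)))
         (no-NE : (h : Emb P C) → ¬ (∀ i → NE C J (pt h i)))
         (w : Fin n) (w-above : ∀ j → j ∈ J → Conf._<ʸ_ C j w) where
  open Conf C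

  extend-by-three : (Extension Λ M P C J → ⊥) → ⊥
  extend-by-three found =
    leftmostPair C J-block λ f f₂ f∈J f-min f₂∈J f<f₂ →
    least Y (λ w → ∀ j → j ∈ J → j <ʸ w) (w , w-above) λ g g-above g-min →
      found (extension f f₂ f∈J f-min f₂∈J f<f₂ g g-above g-min)
    where
    module _ (f f₂ : Fin n) (f∈J : f ∈ J) (f-min : ∀ b → b ∈ J → f ≤ˣ b)
             (f₂∈J : f₂ ∈ J) (f<f₂ : f <ˣ f₂) (g : Fin n) (g-above : ∀ j → j ∈ J → j <ʸ g)
             (g-min : ∀ b → (∀ j → j ∈ J → j <ʸ b) → g ≤ʸ b) where
      B : Block J
      B = ProperBlock.isBlock J-block

      -- The points `t`, `s`, `r` enter in this order, each as `zero`, which puts one more `suc` on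
      -- all others. Consecutive from left to right are `s`, `r`, `f`, `t`; from bottom to top `s`,
      -- `t`, `g`, `r`.
      C₁ : Conf (1 + n)
      C₁ = insertAbove X f , insertBelow Y g
      C₂ : Conf (2 + n)
      C₂ = insertBelow (Conf.X C₁) (suc f) , insertBelow (Conf.Y C₁) zero
      C₃ : Conf (3 + n)
      C₃ = insertBelow (Conf.X C₂) (suc (suc f)) , insertAbove (Conf.Y C₂) (suc (suc g))
      module C₁ = Conf C₁
      module C₂ = Conf C₂
      module C₃ = Conf C₃

      r s t : Fin (3 + n)
      r = zero
      s = suc zero
      t = suc (suc zero)
      old : Fin n → Fin (3 + n)
      old a = suc (suc (suc a))

      f<g : f <ʸ g
      f<g = g-above f f∈J

      -- Being left of `f`, the point is outside `J`. If it were above one element of `J` it would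
      -- be above all of them, hence not below `g`.
      to-SW : ∀ {a} → a <ˣ f → a <ʸ g → SW C J a
      to-SW {a} a<f a<g j j∈ = below-convex X (proj₁ B) a∉ f∈J j∈ a<f , left
        where
        a∉ : a ∉ J
        a∉ a∈ with f-min a a∈
        ... | inj₁ refl = irrˣ a<f
        ... | inj₂ f<a  = asymˣ a<f f<a
        left : a <ʸ j
        left with decʸ a j
        ... | inj₁ p = p
        ... | inj₂ (inj₁ refl) = contradiction j∈ a∉
        ... | inj₂ (inj₂ j<a) =
          ⊥-elim (irrʸ (<-≤-transʸ a<g (g-min a λ i i∈ → above-convex Y (proj₂ B) a∉ j∈ i∈ j<a)))

      to-NE : ∀ {a} → f <ˣ a → g ≤ʸ a → NE C J a
      to-NE {a} f<a g≤a j j∈ =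
        above-convex X (proj₁ B) a∉ f∈J j∈ f<a , <-≤-transʸ (g-above j j∈) g≤a
        where
        a∉ : a ∉ J
        a∉ a∈ = irrʸ (<-≤-transʸ (g-above a a∈) g≤a)

      below-r : ∀ q → q C₃.↗ r → q ≡ s ⊎ ∃ λ a → q ≡ old a × a <ˣ f × a ≤ʸ g
      below-r (suc zero)          _                = inj₁ refl
      below-r (suc (suc zero))    (p , _)          = ⊥-elim (irrˣ p)
      below-r (suc (suc (suc a))) (p , inj₁ refl)  = inj₂ (a , refl , p , inj₁ refl)
      below-r (suc (suc (suc a))) (p , inj₂ q)     = inj₂ (a , refl , p , inj₂ q)

      below-s : ∀ q → q C₃.↗ s → ∃ λ a → q ≡ old a × SW C J a
      below-s zero                (inj₁ () , _)
      below-s zero                (inj₂ p , _) = ⊥-elim (irrˣ p)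
      below-s (suc (suc zero))    (p , _) = ⊥-elim (irrˣ p)
      below-s (suc (suc (suc a))) (p , q) = a , refl , to-SW p q

      below-t : ∀ q → q C₃.↗ t → q ≡ s ⊎ ∃ λ a → q ≡ old a × a ≤ˣ f × a <ʸ g
      below-t zero                (_ , p) = ⊥-elim (irrʸ p)
      below-t (suc zero)          _       = inj₁ refl
      below-t (suc (suc (suc a))) (p , q) = inj₂ (a , refl , p , q)

      above-r : ∀ q → r C₃.↗ q → ∃ λ a → q ≡ old a × NE C J a
      above-r (suc zero)          (_ , p)         = ⊥-elim (irrʸ p)
      above-r (suc (suc zero))    (_ , p)         = ⊥-elim (irrʸ p)
      above-r (suc (suc (suc a))) (inj₁ refl , p) = ⊥-elim (asymʸ f<g p)
      above-r (suc (suc (suc a))) (inj₂ p , q)    = a , refl , to-NE p (inj₂ q)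

      above-t : ∀ q → t C₃.↗ q → ∃ λ a → q ≡ old a × NE C J a
      above-t zero                (p , _) = ⊥-elim (irrˣ p)
      above-t (suc zero)          (p , _) = ⊥-elim (irrˣ p)
      above-t (suc (suc zero))    (() , _)
      above-t (suc (suc (suc a))) (p , q) = a , refl , to-NE p q

      above-s : ∀ q → s C₃.↗ q → q ≢ r → q ≢ t → ∃ λ a → q ≡ old a × NE C J a
      above-s zero                _ q≢r _ = contradiction refl q≢r
      above-s (suc zero)          (() , _)
      above-s (suc (suc zero))    _ _ q≢t = contradiction refl q≢t
      above-s (suc (suc (suc a))) (_ , inj₁ ())
      above-s (suc (suc (suc a))) (inj₁ refl , inj₂ q) _ _ = ⊥-elim (irrʸ (<-≤-transʸ f<g q))
      above-s (suc (suc (suc a))) (inj₂ p , inj₂ q) _ _    = a , refl , to-NE p q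

      -- A point south-west of `r` may be `g`, and one south-west of `t` may be `f`, so a single
      -- step need not lead south-west of `J`. A second step makes the bound strict; between `P` and
      -- `Λ` a point of `M` supplies it.
      below-below-r : ∀ p q → p C₃.↗ q → q C₃.↗ r → ∃ λ a → p ≡ old a × SW C J a
      below-below-r p q p↗q q↗r with below-r q q↗r
      ... | inj₁ refl = below-s p p↗q
      ... | inj₂ (a , refl , a<f , a≤g) with below-r p (C₃.↗-trans {p} {q} p↗q q↗r)
      ...   | inj₁ refl = ⊥-elim (irrˣ (≤-<-transˣ (old-≤ (proj₁ p↗q)) a<f))
        where
        old-≤ : suc f C₁.≤ˣ suc a → f ≤ˣ a
        old-≤ (inj₁ refl) = inj₁ refl
        old-≤ (inj₂ p)    = inj₂ p
      ...   | inj₂ (b , refl , b<f , _) =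
        b , refl , to-SW b<f (<-≤-transʸ (proj₂ p↗q) a≤g)

      below-below-t : ∀ p q → p C₃.↗ q → q C₃.↗ t → ∃ λ a → p ≡ old a × SW C J a
      below-below-t p q p↗q q↗t with below-t q q↗t
      ... | inj₁ refl = below-s p p↗q
      ... | inj₂ (a , refl , a≤f , a<g) with below-t p (C₃.↗-trans {p} {q} p↗q q↗t)
      ...   | inj₁ refl = ⊥-elim (irrʸ (<-≤-transʸ a<g (old-≤ (proj₂ p↗q))))
        where
        old-≤ : zero C₁.≤ʸ suc a → g ≤ʸ a
        old-≤ (inj₂ p) = p
      ...   | inj₂ (b , refl , _ , b<g) =
        b , refl , to-SW (<-≤-transˣ (proj₁ p↗q) a≤f) b<g

      module _ (d : Emb Λ C₃) (e : Emb M C₃) (h : Emb P C₃)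
               (p : ∀ i j → pt d i C₃.↗ pt e j) (q : ∀ i j → pt e i C₃.↗ pt h j) where

        d↗h : ∀ i j → pt d i C₃.↗ pt h j
        d↗h i j = C₃.↗-trans {pt d i} {pt e μ₀} (p i μ₀) (q μ₀ j)

        -- A new point in the copy would force all of `Λ` south-west of `J` or all of `P` north-east
        -- of it. Both are excluded by hypothesis.
        no-below : (∀ i → ∃ λ a → pt d i ≡ old a × SW C J a) → ⊥
        no-below od = no-SW (restrict {C = C} {C₃} id id d od) (proj₂ ∘ proj₂ ∘ od)

        no-above : (∀ i → ∃ λ a → pt h i ≡ old a × NE C J a) → ⊥
        no-above oh = no-NE (restrict {C = C} {C₃} id id h oh) (proj₂ ∘ proj₂ ∘ oh)

        r∉e : ∀ i → pt e i ≢ r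
        r∉e i eq = no-above λ j → above-r (pt h j) (subst (C₃._↗ pt h j) eq (q i j))
        t∉e : ∀ i → pt e i ≢ t
        t∉e i eq = no-above λ j → above-t (pt h j) (subst (C₃._↗ pt h j) eq (q i j))
        r∉d : ∀ i → pt d i ≢ r
        r∉d i eq = no-above λ j → above-r (pt h j) (subst (C₃._↗ pt h j) eq (d↗h i j))
        t∉d : ∀ i → pt d i ≢ t
        t∉d i eq = no-above λ j → above-t (pt h j) (subst (C₃._↗ pt h j) eq (d↗h i j))
        r∉h : ∀ i → pt h i ≢ r
        r∉h i eq = no-below λ j →
          below-below-r (pt d j) (pt e μ₀) (p j μ₀) (subst (pt e μ₀ C₃.↗_) eq (q μ₀ i))
        t∉h : ∀ i → pt h i ≢ t
        t∉h i eq = no-below λ j →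
          below-below-t (pt d j) (pt e μ₀) (p j μ₀) (subst (pt e μ₀ C₃.↗_) eq (q μ₀ i))
        s∉e : ∀ i → pt e i ≢ s
        s∉e i eq = no-below λ j → below-s (pt d j) (subst (pt d j C₃.↗_) eq (p j i))
        s∉h : ∀ i → pt h i ≢ s
        s∉h i eq = no-below λ j → below-s (pt d j) (subst (pt d j C₃.↗_) eq (d↗h j i))
        -- Both `r` and `t` are north-east of `s`, so they must be excluded from `P` first.
        s∉d : ∀ i → pt d i ≢ s
        s∉d i eq = no-above λ j →
          above-s (pt h j) (subst (C₃._↗ pt h j) eq (d↗h i j)) (r∉h j) (t∉h j)

        is-old : ∀ q → q ≢ r → q ≢ s → q ≢ t → ∃ λ a → q ≡ old a × ⊤
        is-old zero                q≢r _ _ = contradiction refl q≢r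
        is-old (suc zero)          _ q≢s _ = contradiction refl q≢s
        is-old (suc (suc zero))    _ _ q≢t = contradiction refl q≢t
        is-old (suc (suc (suc a))) _ _ _   = a , refl , tt

        no-copy : ⊥
        no-copy = avoids-old {C = C} {C₃} id id avoid d e h
          (λ i → is-old (pt d i) (r∉d i) (s∉d i) (t∉d i))
          (λ i → is-old (pt e i) (r∉e i) (s∉e i) (t∉e i))
          (λ i → is-old (pt h i) (r∉h i) (s∉h i) (t∉h i)) p q

      module _ {I} (blk : C₃.Block I) where

        Full : Set
        Full = (∀ (i : Fin 3) → i ↑ˡ n ∈ I) × old g ∈ I × old f ∈ I

        s<ʸt : s C₃.<ʸ t
        s<ʸt = inj₁ refl
        r<ˣt : r C₃.<ˣ t
        r<ˣt = inj₂ (inj₁ refl)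
        s<ˣr : s C₃.<ˣ r
        s<ˣr = inj₁ refl

        -- The case to which all others reduce: `g` is between `t` and `r` in height, `f` is between
        -- `r` and `t` horizontally, and `s` is between `f` and `t` in height.
        r-t : r ∈ I → t ∈ I → Full
        r-t r∈ t∈ = (λ { zero → r∈ ; (suc zero) → s∈ ; (suc (suc zero)) → t∈ })
          , proj₂ blk {c = r} t∈ r∈ (inj₁ refl) (inj₁ refl) , f∈
          where
          f∈ : old f ∈ I
          f∈ = proj₁ blk {c = t} r∈ t∈ (inj₁ refl) (inj₁ refl)
          s∈ : s ∈ I
          s∈ = proj₂ blk {b = s} {t} f∈ t∈ f<g s<ʸt

        s-t : s ∈ I → t ∈ I → Full
        s-t s∈ t∈ = r-t (proj₁ blk {b = r} {t} s∈ t∈ s<ˣr r<ˣt) t∈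

        r-f : r ∈ I → old f ∈ I → Full
        r-f r∈ f∈ = r-t r∈ (proj₂ blk {b = t} {r} f∈ r∈ f<g (inj₂ (inj₁ refl)))

        r-s : r ∈ I → s ∈ I → Full
        r-s r∈ s∈ = s-t s∈ (proj₂ blk {b = t} {r} s∈ r∈ s<ʸt (inj₂ (inj₁ refl)))

        t-J : t ∈ I → ∀ {j} → j ∈ J → old j ∈ I → Full
        t-J t∈ {j} j∈J j∈ = s-t (proj₂ blk {b = s} {t} j∈ t∈ (g-above j j∈J) s<ʸt) t∈

        t-old : t ∈ I → ∀ a → old a ∈ I → Full
        t-old t∈ a a∈ with cmpˣ a f
        ... | inj₁ a<f         = t-J t∈ f∈J (proj₁ blk {c = t} a∈ t∈ a<f (inj₁ refl))
        ... | inj₂ (inj₁ refl) = t-J t∈ f∈J a∈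
        ... | inj₂ (inj₂ f<a) with cmpˣ a f₂
        ...   | inj₁ a<f₂        = t-J t∈ (proj₁ B f∈J f₂∈J f<a a<f₂) a∈
        ...   | inj₂ (inj₁ refl) = t-J t∈ f₂∈J a∈
        ...   | inj₂ (inj₂ f₂<a) = t-J t∈ f₂∈J (proj₁ blk {t} t∈ a∈ f<f₂ f₂<a)

        r-old : r ∈ I → ∀ a → old a ∈ I → Full
        r-old r∈ a a∈ with cmpˣ a f
        ... | inj₁ a<f         = r-s r∈ (proj₁ blk {b = s} {r} a∈ r∈ a<f s<ˣr)
        ... | inj₂ (inj₁ refl) = r-f r∈ a∈
        ... | inj₂ (inj₂ f<a)  = r-f r∈ (proj₁ blk {r} r∈ a∈ (inj₁ refl) f<a)

        s-old : s ∈ I → ∀ a → old a ∈ I → Full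
        s-old s∈ a a∈ with decˣ a f | decʸ a g
        ... | inj₂ f≤a | _ = r-s (proj₁ blk {s} {r} s∈ a∈ s<ˣr (lift f≤a)) s∈
          where
          lift : f ≤ˣ a → suc (suc f) C₂.≤ˣ suc (suc a)
          lift (inj₁ refl) = inj₁ refl
          lift (inj₂ p)    = inj₂ p
        ... | inj₁ a<f | inj₂ g≤a = s-t s∈ (proj₂ blk {s} {t} s∈ a∈ s<ʸt g≤a)
        -- Here `a` is south-west of `J`, so `f` is between `a` and `s` in height, and then `r` is
        -- between `s` and `f` horizontally.
        ... | inj₁ a<f | inj₁ a<g =
          r-s (proj₁ blk {s} {r} {old f} s∈ f∈ s<ˣr (inj₁ refl)) s∈
          where
          f∈ : old f ∈ I
          f∈ = proj₂ blk {c = s} a∈ s∈ (proj₂ (to-SW a<f a<g f f∈J)) f<g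

        absorbs : ∀ i → i ↑ˡ n ∈ I → ∀ b → b ∈ I → b ≢ i ↑ˡ n → Full
        absorbs zero             r∈ zero                b∈ b≢ = contradiction refl b≢
        absorbs zero             r∈ (suc zero)          b∈ _  = r-s r∈ b∈
        absorbs zero             r∈ (suc (suc zero))    b∈ _  = r-t r∈ b∈
        absorbs zero             r∈ (suc (suc (suc a))) b∈ _  = r-old r∈ a b∈
        absorbs (suc zero)       s∈ zero                b∈ _  = r-s b∈ s∈
        absorbs (suc zero)       s∈ (suc zero)          b∈ b≢ = contradiction refl b≢
        absorbs (suc zero)       s∈ (suc (suc zero))    b∈ _  = s-t s∈ b∈
        absorbs (suc zero)       s∈ (suc (suc (suc a))) b∈ _  = s-old s∈ a b∈
        absorbs (suc (suc zero)) t∈ zero                b∈ _  = r-t b∈ t∈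
        absorbs (suc (suc zero)) t∈ (suc zero)          b∈ _  = s-t b∈ t∈
        absorbs (suc (suc zero)) t∈ (suc (suc zero))    b∈ b≢ = contradiction refl b≢
        absorbs (suc (suc zero)) t∈ (suc (suc (suc a))) b∈ _  = t-old t∈ a b∈

      extension : Extension Λ M P C J
      extension = record
        { new = 3 ; conf = C₃ ; oldˣ = id ; oldʸ = id ; avoids = no-copy
        ; f = f ; f₂ = f₂ ; e = g ; f∈J = f∈J ; f₂∈J = f₂∈J
        ; e∉J = λ g∈J → irrʸ (g-above g g∈J)
        ; splits = λ blk f∈ f₂∈ → suc (suc zero) , proj₁ blk {old f} {t} f∈ f₂∈ (inj₁ refl) f<f₂
        ; full = absorbs
        }

-- The choice of construction.

reverse-avoids : {Λ : Conf k} {M : Conf l} {P : Conf m} {C : Conf n} →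
  Avoids Λ M P C → Avoids (reverse P) (reverse M) (reverse Λ) (reverse C)
reverse-avoids avoid e f g p q =
  avoid (unreverseᵉ g) (unreverseᵉ f) (unreverseᵉ e) (λ i j → q j i) (λ i j → p j i)

reverse-block : {C : Conf n} {J : Subset n} → ProperBlock C J → ProperBlock (reverse C) J
reverse-block B = record
  { isBlock = (λ a∈ c∈ p q → proj₁ isBlock c∈ a∈ q p) , (λ a∈ c∈ p q → proj₂ isBlock c∈ a∈ q p)
  ; u∈ = u∈ ; v∈ = v∈ ; u≢v = u≢v ; w∉ = w∉ }
  where open ProperBlock B

module _ {Λ : Conf k} {M : Conf l} {P : Conf m} (λ₀ : Fin k) (μ₀ : Fin l) (ρ₀ : Fin m) where

  extend : {C : Conf n} → Avoids Λ M P C → ∀ {J} → ProperBlock C J →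
           (Extension Λ M P C J → ⊥) → ⊥
  extend {C = C} avoid {J} B found = em {A = Σ (Emb Λ C) λ d → ∀ i → SW C J (pt d i)} λ
    { (inj₁ (low , low-SW)) → extend-by-one λ₀ μ₀ avoid B low low-SW found
    ; (inj₂ no-SW) → em {A = Σ (Emb P C) λ h → ∀ i → NE C J (pt h i)} λ
      { (inj₁ (high , high-NE)) →
          extend-by-one ρ₀ μ₀ (reverse-avoids avoid) (reverse-block B) (reverseᵉ high) high-NE
            (found ∘ reverse-extension)
      ; (inj₂ no-NE) → apart (λ d p → no-SW (d , p)) (λ h p → no-NE (h , p)) (cmpʸ u w) } }
    where
    open Conf C
    open ProperBlock B
    apart : ((d : Emb Λ C) → ¬ (∀ i → SW C J (pt d i))) →
            ((h : Emb P C) → ¬ (∀ i → NE C J (pt h i))) → u <ʸ w ⊎ u ≡ w ⊎ w <ʸ u → ⊥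
    apart no-SW no-NE (inj₁ u<w) = extend-by-three μ₀ avoid B no-SW no-NE w
      (λ j j∈ → above-convex Y (proj₂ isBlock) w∉ u∈ j∈ u<w) found
    apart no-SW no-NE (inj₂ (inj₁ refl)) = w∉ u∈
    -- The half turn brings `w` above `J` and exchanges the two nonexistence hypotheses.
    apart no-SW no-NE (inj₂ (inj₂ w<u)) =
      extend-by-three μ₀ (reverse-avoids avoid) (reverse-block B)
        (λ d → no-NE (unreverseᵉ d)) (λ h → no-SW (unreverseᵉ h)) w
        (λ j j∈ → below-convex Y (proj₂ isBlock) w∉ u∈ j∈ w<u) (found ∘ reverse-extension)

-- Traces of the new blocks on the old points.

∈-++ˡ : (S : Subset k) (T : Subset n) {i : Fin k} → i ∈ S → i ↑ˡ n ∈ S ++ T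
∈-++ˡ S T {i} i∈ = Vecₚ.lookup⇒[]= _ _ (trans (Vecₚ.lookup-++ˡ S T i) (Vecₚ.[]=⇒lookup i∈))

∈-++ˡ⁻ : (S : Subset k) (T : Subset n) {i : Fin k} → i ↑ˡ n ∈ S ++ T → i ∈ S
∈-++ˡ⁻ S T {i} i∈ =
  Vecₚ.lookup⇒[]= _ _ (trans (sym (Vecₚ.lookup-++ˡ S T i)) (Vecₚ.[]=⇒lookup i∈))

∈-++ʳ : (S : Subset k) (T : Subset n) {i : Fin n} → i ∈ T → k ↑ʳ i ∈ S ++ T
∈-++ʳ S T {i} i∈ = Vecₚ.lookup⇒[]= _ _ (trans (Vecₚ.lookup-++ʳ S T i) (Vecₚ.[]=⇒lookup i∈))

∈-++ʳ⁻ : (S : Subset k) (T : Subset n) {i : Fin n} → k ↑ʳ i ∈ S ++ T → i ∈ T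
∈-++ʳ⁻ S T {i} i∈ =
  Vecₚ.lookup⇒[]= _ _ (trans (sym (Vecₚ.lookup-++ʳ S T i)) (Vecₚ.[]=⇒lookup i∈))

data Position (k n : ℕ) : Fin (k + n) → Set where
  left  : ∀ i → Position k n (i ↑ˡ n)
  right : ∀ a → Position k n (k ↑ʳ a)

position : ∀ k {n} (q : Fin (k + n)) → Position k n q
position zero    q       = right q
position (suc k) zero    = left zero
position (suc k) (suc q) with position k q
... | left i  = left (suc i)
... | right a = right a

↑ˡ≢↑ʳ : ∀ (i : Fin k) (a : Fin n) → i ↑ˡ n ≢ k ↑ʳ a
↑ˡ≢↑ʳ (suc i) a eq = ↑ˡ≢↑ʳ i a (Finₚ.suc-injective eq)

-- At most two elements, in a form that transfers along injections without counting.
Thin : Subset n → Set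
Thin S = ∀ {a b c} → a ∈ S → b ∈ S → c ∈ S → a ≡ b ⊎ b ≡ c ⊎ a ≡ c

module _ {Λ : Conf k} {M : Conf l} {P : Conf m} {C : Conf n} {J : Subset n}
         (E : Extension Λ M P C J) where
  open Extension E
  private module C = Conf C

  Touched : Subset n → Set
  Touched S = C.Block S × e ∈ S × f ∈ S × ∃ (_∉ S)

  old-block : (N : Subset new) (S : Subset n) → Conf.Block conf (N ++ S) → C.Block S
  old-block N S (cx , cy) =
    (λ a∈ c∈ p q → ∈-++ʳ⁻ N S (cx (∈-++ʳ N S a∈) (∈-++ʳ N S c∈) (oldˣ p) (oldˣ q))) ,
    (λ a∈ c∈ p q → ∈-++ʳ⁻ N S (cy (∈-++ʳ N S a∈) (∈-++ʳ N S c∈) (oldʸ p) (oldʸ q)))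

  -- By `full`, a proper block has none or all of the new points. With none, `splits` keeps it from
  -- containing `J`; with all, the point that it misses is an old one.
  trace : ∀ {I} → ProperBlock conf I →
    (∃ λ S → I ≡ replicate new false ++ S × ProperBlock C S × ¬ J ⊆ˢ S) ⊎
    (∃ λ S → I ≡ replicate new true ++ S × Touched S × ∃ λ i → i ↑ˡ n ∈ I)
  trace {I} B with Vec.splitAt new I
  ... | N , S , refl with Finₚ.any? (λ i → i ∈? N)
  ... | no none = inj₁ (S , cong (_++ S) (Empty-unique none) , block , J⊈S)
    where
    open ProperBlock B
    J⊈S : ¬ J ⊆ˢ S
    J⊈S J⊆S = let i , i∈ = splits isBlock (∈-++ʳ N S (J⊆S f∈J)) (∈-++ʳ N S (J⊆S f₂∈J)) in
              none (i , ∈-++ˡ⁻ N S i∈)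
    old : ∀ {q} → q ∈ N ++ S → ∃ λ a → q ≡ new ↑ʳ a × a ∈ S
    old {q} q∈ with position new q
    ... | left i  = contradiction (i , ∈-++ˡ⁻ N S q∈) none
    ... | right a = a , refl , ∈-++ʳ⁻ N S q∈
    outside-S : ∃ (_∉ S)
    outside-S with f ∈? S | f₂ ∈? S
    ... | no f∉  | _      = f , f∉
    ... | yes _  | no f₂∉ = f₂ , f₂∉
    ... | yes f∈ | yes f₂∈ = let i , i∈ = splits isBlock (∈-++ʳ N S f∈) (∈-++ʳ N S f₂∈) in
                             contradiction (i , ∈-++ˡ⁻ N S i∈) none
    block : ProperBlock C S
    block = let _ , u≡ , u∈S = old u∈ ; _ , v≡ , v∈S = old v∈ in record
      { isBlock = old-block N S isBlock ; u∈ = u∈S ; v∈ = v∈S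
      ; u≢v = λ eq → u≢v (trans u≡ (trans (cong (new ↑ʳ_) eq) (sym v≡)))
      ; w∉ = proj₂ outside-S }
  ... | yes (i , i∈N) = 
    inj₂ (S , cong (_++ S) N≡ , (old-block N S isBlock , e∈S , f∈S , outside-S) , i , i∈)
    where
    open ProperBlock B
    i∈ : i ↑ˡ n ∈ N ++ S
    i∈ = ∈-++ˡ N S i∈N
    other : ∃ λ b → b ∈ N ++ S × b ≢ i ↑ˡ n
    other with u Finₚ.≟ i ↑ˡ n
    ... | no u≢    = u , u∈ , u≢
    ... | yes refl = v , v∈ , u≢v ∘ sym
    absorbed : (∀ j → j ↑ˡ n ∈ N ++ S) × new ↑ʳ e ∈ N ++ S × new ↑ʳ f ∈ N ++ S
    absorbed = full isBlock i i∈ (proj₁ other) (proj₁ (proj₂ other)) (proj₂ (proj₂ other))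
    e∈S = ∈-++ʳ⁻ N S (proj₁ (proj₂ absorbed))
    f∈S = ∈-++ʳ⁻ N S (proj₂ (proj₂ absorbed))
    N≡ : N ≡ replicate new true
    N≡ = ⊆-antisym (⊆-max N) λ {j} _ → ∈-++ˡ⁻ N S (proj₁ absorbed j)
    outside-S : ∃ (_∉ S)
    outside-S = go w w∉
      where
      go : ∀ q → q ∉ N ++ S → ∃ (_∉ S)
      go q q∉ with position new q
      ... | left j  = contradiction (proj₁ absorbed j) q∉
      ... | right a = a , q∉ ∘ ∈-++ʳ N S

  -- A proper block with a new point also contains `e` and `f`, which makes three distinct points.
  thin-trace : ∀ {I} → ProperBlock conf I → Thin I →
    ∃ λ S → I ≡ replicate new false ++ S × ProperBlock C S × ¬ J ⊆ˢ S × Thin S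
  thin-trace B thin with trace B
  ... | inj₁ (S , refl , B′ , J⊈S) = S , refl , B′ , J⊈S , λ a∈ b∈ c∈ →
    Sum.map (Finₚ.↑ʳ-injective new _ _)
      (Sum.map (Finₚ.↑ʳ-injective new _ _) (Finₚ.↑ʳ-injective new _ _))
      (thin (∈-++ʳ _ S a∈) (∈-++ʳ _ S b∈) (∈-++ʳ _ S c∈))
  ... | inj₂ (S , refl , (_ , e∈ , f∈ , _) , i , i∈)
      with thin i∈ (∈-++ʳ (replicate new true) S e∈) (∈-++ʳ (replicate new true) S f∈)
  ...   | inj₁ eq        = contradiction eq (↑ˡ≢↑ʳ i e)
  ...   | inj₂ (inj₂ eq) = contradiction eq (↑ˡ≢↑ʳ i f)
  ...   | inj₂ (inj₁ eq) = contradiction f∈J (subst (_∉ J) (Finₚ.↑ʳ-injective new _ _ eq) e∉J)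

-- Counting the blocks.

-- The effect of an extension on the blocks that survive it: those containing J absorb all the
-- new points.
inflate : ∀ k → Subset n → Subset n → Subset (k + n)
inflate k J S = replicate k (does (J ⊆? S)) ++ S

inflate-⊆ : ∀ k {J S : Subset n} → J ⊆ˢ S → inflate k J S ≡ replicate k true ++ S
inflate-⊆ k {J} {S} J⊆S = cong (λ b → replicate k b ++ S) (dec-true (J ⊆? S) J⊆S)

inflate-⊈ : ∀ k {J S : Subset n} → ¬ J ⊆ˢ S → inflate k J S ≡ replicate k false ++ S
inflate-⊈ k {J} {S} J⊈S = cong (λ b → replicate k b ++ S) (dec-false (J ⊆? S) J⊈S)

⊈⇒≢ : {J S : Subset n} → ¬ J ⊆ˢ S → S ≢ J
⊈⇒≢ J⊈S refl = J⊈S id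

-- The length of such a list serves as induction measure: it bounds the number of solutions of `Q`
-- and asks for no decision of `Q`.
Covers : {A : Set} → List A → (A → Set) → Set
Covers xs Q = ∀ x → Q x → x ∈ˡ xs

_≟ˢ_ : (S T : Subset n) → Dec (S ≡ T)
_≟ˢ_ = Vecₚ.≡-dec Boolₚ._≟_

module _ (k : ℕ) {J : Subset n} {Q : Subset n → Set} {Q⁺ : Subset (k + n) → Set}
         (lift : ∀ I → Q⁺ I → ∃ λ S → I ≡ inflate k J S × Q S × S ≢ J) where

  descend : List (Subset n) → List (Subset (k + n))
  descend xs = List.map (inflate k J) (List.filter (λ S → ¬? (S ≟ˢ J)) xs)

  descend-length : ∀ xs → J ∈ˡ xs → length (descend xs) ℕ.< length xs
  descend-length xs J∈ = subst (ℕ._< length xs) (sym (Listₚ.length-map _ (List.filter _ xs)))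
    (Listₚ.filter-notAll (λ S → ¬? (S ≟ˢ J)) xs (Any.map (λ J≡S S≢J → S≢J (sym J≡S)) J∈))

  descend-covers : ∀ xs → Covers xs Q → Covers (descend xs) Q⁺
  descend-covers xs covers I q with lift I q
  ... | S , refl , qS , S≢J =
    ∈-map⁺ (inflate k J) (∈-filter⁺ (λ S → ¬? (S ≟ˢ J)) (covers S qS) S≢J)

allSubsets : ∀ n → List (Subset n)
allSubsets zero    = [] ∷ []
allSubsets (suc n) = List.map (true ∷_) (allSubsets n) List.++ List.map (false ∷_) (allSubsets n)

∈-allSubsets : (S : Subset n) → S ∈ˡ allSubsets n
∈-allSubsets []          = here refl
∈-allSubsets (true ∷ S)  = ∈-++⁺ˡ (∈-map⁺ (true ∷_) (∈-allSubsets S))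
∈-allSubsets (false ∷ S) =
  ∈-++⁺ʳ (List.map (true ∷_) (allSubsets _)) (∈-map⁺ (false ∷_) (∈-allSubsets S))

-- Minimal blocks.

-- The descent itself proves minimality: a smaller proper block leads to `⊥` by recursion.
minimalBlock : {C : Conf n} {S : Subset n} → ProperBlock C S →
  (∀ J → ProperBlock C J → (∀ K → K ⊂ J → ¬ ProperBlock C K) → ⊥) → ⊥
minimalBlock {C = C} {S} B found = go S (<-wellFounded _) B
  where
  go : ∀ S → Acc ℕ._<_ ∣ S ∣ → ProperBlock C S → ⊥
  go S (acc rs) B = found S B λ K K⊂S → go K (rs (p⊂q⇒∣p∣<∣q∣ K⊂S))

-- A block overlapping J splits it into two blocks, of which one is not a singleton
-- unless J has only two elements.
minimal⇒⊆ : {C : Conf n} {J S : Subset n} → ProperBlock C J →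
  (∀ K → K ⊂ J → ¬ ProperBlock C K) → ¬ Thin J → Conf.Block C S →
  ∀ {e f} → e ∈ S → e ∉ J → f ∈ S → f ∈ J → J ⊆ˢ S
minimal⇒⊆ {C = C} {J} {S} B minimal ¬thin (cxS , cyS) {e} {f} e∈S e∉J f∈S f∈J {j} j∈J
  with j ∈? S
... | yes j∈S = j∈S
... | no j∉S  = ⊥-elim (¬thin thin)
  where
  open Conf C
  cxJ = proj₁ (ProperBlock.isBlock B)
  cyJ = proj₂ (ProperBlock.isBlock B)

  inner : ∀ {a b} → a ∈ J → b ∈ J → a ∈ S → b ∈ S → a ≡ b
  inner {a} {b} a∈J b∈J a∈S b∈S with a Finₚ.≟ b
  ... | yes a≡b = a≡b
  ... | no a≢b  = ⊥-elim (minimal (J ∩ S)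
    (p∩q⊆p J S , j , j∈J , λ j∈ → j∉S (proj₂ (x∈p∩q⁻ J S j∈)))
    record { isBlock = convex-∩ X cxJ cxS , convex-∩ Y cyJ cyS
           ; u∈ = x∈p∩q⁺ (a∈J , a∈S) ; v∈ = x∈p∩q⁺ (b∈J , b∈S) ; u≢v = a≢b
           ; w∉ = λ j∈ → j∉S (proj₂ (x∈p∩q⁻ J S j∈)) })

  outer : ∀ {a b} → a ∈ J → b ∈ J → a ∉ S → b ∉ S → a ≡ b
  outer {a} {b} a∈J b∈J a∉S b∉S with a Finₚ.≟ b
  ... | yes a≡b = a≡b
  -- Removing `S` leaves a block because `S` reaches beyond `J` at `e`, and a smaller one because
  -- `f` goes.
  ... | no a≢b  = ⊥-elim (minimal (J ∩ ∁ S) (p∩q⊆p J (∁ S) , f , f∈J , f∉)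
    record { isBlock = convex-∖ X cxJ cxS e∈S e∉J , convex-∖ Y cyJ cyS e∈S e∉J
           ; u∈ = x∈p∩q⁺ (a∈J , x∉p⇒x∈∁p a∉S) ; v∈ = x∈p∩q⁺ (b∈J , x∉p⇒x∈∁p b∉S)
           ; u≢v = a≢b ; w∉ = f∉ })
    where
    f∉ : f ∉ J ∩ ∁ S
    f∉ f∈ = x∈∁p⇒x∉p (proj₂ (x∈p∩q⁻ J (∁ S) f∈)) f∈S

  -- Of any three elements of `J`, two agree on membership in `S`.
  thin : Thin J
  thin {a} {b} {c} a∈ b∈ c∈ with a ∈? S | b ∈? S | c ∈? S
  ... | yes p | yes q | _     = inj₁ (inner a∈ b∈ p q)
  ... | no p  | no q  | _     = inj₁ (outer a∈ b∈ p q)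
  ... | yes _ | no q  | no r  = inj₂ (inj₁ (outer b∈ c∈ q r))
  ... | no _  | yes q | yes r = inj₂ (inj₁ (inner b∈ c∈ q r))
  ... | yes p | no _  | yes r = inj₂ (inj₂ (inner a∈ c∈ p r))
  ... | no p  | yes _ | no r  = inj₂ (inj₂ (outer a∈ c∈ p r))

-- Removal of all blocks by induction on their number.

module _ {Λ : Conf k} {M : Conf l} {P : Conf m} (λ₀ : Fin k) (μ₀ : Fin l) (ρ₀ : Fin m)
         {σ : Conf o}
         (no-simple : ∀ {n} (C : Conf n) → Emb σ C → Avoids Λ M P C →
                      ¬ (∀ S → ¬ ProperBlock C S)) where
  open Extension

  include : {C : Conf n} {J : Subset n} (E : Extension Λ M P C J) → Emb C (conf E)
  include E = record { pt = new E ↑ʳ_ ; monoˣ = oldˣ E ; monoʸ = oldʸ E }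

  -- Without thin blocks, `minimal⇒⊆` applies to a minimal `J`. A block with new points then has a
  -- trace strictly larger than `J`, and one without them does not contain `J`; each is the
  -- inflation of an old block other than `J`. By `thin-trace`, no thin block arises.
  remove-blocks : (C : Conf n) → Emb σ C → Avoids Λ M P C →
    (∀ S → ProperBlock C S → ¬ Thin S) →
    ∀ xs → Acc ℕ._<_ (length xs) → Covers xs (ProperBlock C) → ⊥
  remove-blocks C emb avoid thick xs (acc rs) covers =
    no-simple C emb avoid λ _ B₀ → minimalBlock B₀ λ J B minimal →
    extend λ₀ μ₀ ρ₀ avoid B λ E →
      let lift : ∀ I → ProperBlock (conf E) I →
                 ∃ λ S → I ≡ inflate (new E) J S × ProperBlock C S × S ≢ J
          lift I B⁺ = case trace E B⁺ of λ
            { (inj₁ (S , I≡ , B′ , J⊈S)) →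
                S , trans I≡ (sym (inflate-⊈ (new E) J⊈S)) , B′ , ⊈⇒≢ J⊈S
            ; (inj₂ (S , I≡ , (blk , e∈S , f∈S , _ , w∉) , _)) →
                S , trans I≡ (sym (inflate-⊆ (new E)
                      (minimal⇒⊆ B minimal (thick J B) blk e∈S (e∉J E) f∈S (f∈J E)))) ,
                record { isBlock = blk ; u∈ = e∈S ; v∈ = f∈S ; w∉ = w∉
                       ; u≢v = λ e≡f → e∉J E (subst (_∈ J) (sym e≡f) (f∈J E)) } ,
                λ { refl → e∉J E e∈S } }
      in
      remove-blocks (conf E) (include E ∘ᵉ emb) (avoids E)
        (λ I B⁺ thin → let S , _ , B′ , _ , thin′ = thin-trace E B⁺ thin in thick S B′ thin′)
        (descend (new E) lift xs)
        (rs (descend-length (new E) lift xs (covers J B)))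
        (descend-covers (new E) lift xs covers)

  -- Thin blocks can be cut in any order, since an extension creates no thin block and destroys `J`.
  remove-pairs : (C : Conf n) → Emb σ C → Avoids Λ M P C →
    ∀ xs → Acc ℕ._<_ (length xs) → Covers xs (λ S → ProperBlock C S × Thin S) → ⊥
  remove-pairs C emb avoid xs (acc rs) covers =
    remove-blocks C emb avoid
      -- The recursion runs inside the proof that no thin block exists.
      (λ J B thin → extend λ₀ μ₀ ρ₀ avoid B λ E →
        let lift : ∀ I → ProperBlock (conf E) I × Thin I →
                   ∃ λ S → I ≡ inflate (new E) J S × (ProperBlock C S × Thin S) × S ≢ J
            lift I (B⁺ , thin⁺) =
              let S , I≡ , B′ , J⊈S , thin′ = thin-trace E B⁺ thin⁺ in
              S , trans I≡ (sym (inflate-⊈ (new E) J⊈S)) , (B′ , thin′) , ⊈⇒≢ J⊈S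
        in
        remove-pairs (conf E) (include E ∘ᵉ emb) (avoids E)
          (descend (new E) lift xs)
          (rs (descend-length (new E) lift xs (covers J (B , thin))))
          (descend-covers (new E) lift xs covers))
      (allSubsets _) (<-wellFounded _) (λ S _ → ∈-allSubsets S)

  simple-extension : Emb σ σ → Avoids Λ M P σ → ⊥
  simple-extension emb avoid =
    remove-pairs σ emb avoid (allSubsets _) (<-wellFounded _) (λ S _ → ∈-allSubsets S)

-- Between configurations and permutations.

injective⇒surjective : (f : Fin n → Fin n) → (∀ {a b} → f a ≡ f b → a ≡ b) →
                       ∀ i → ∃ λ a → f a ≡ i
injective⇒surjective {suc n} f inj i with Finₚ.any? (λ a → f a Finₚ.≟ i)
... | yes found = found
... | no none   = contradiction (Finₚ.injective⇒≤ {f = λ a → Fin.punchOut (i≢f a)} λ {a} {b} eq →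
        inj (Finₚ.punchOut-injective (i≢f a) (i≢f b) eq)) ℕₚ.1+n≰n
  where
  i≢f : ∀ a → i ≢ f a
  i≢f a i≡ = none (a , sym i≡)

module _ {P : Fin n → Set} (P? : ∀ a → Dec (P a)) where

  comprehension : Subset n
  comprehension = Vec.tabulate (does ∘ P?)

  ∈-comprehension⁺ : ∀ {a} → P a → a ∈ comprehension
  ∈-comprehension⁺ {a} pa = Vecₚ.lookup⇒[]= a _
    (trans (Vecₚ.lookup∘tabulate (does ∘ P?) a) (dec-true (P? a) pa))

  ∈-comprehension⁻ : ∀ {a} → a ∈ comprehension → P a
  ∈-comprehension⁻ {a} a∈
    with P? a | trans (sym (Vecₚ.lookup∘tabulate (does ∘ P?) a)) (Vecₚ.[]=⇒lookup a∈)
  ... | yes pa | _ = pa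

module Rank (L : Lin n) where
  open Lin L

  _≺?_ : ∀ a b → Dec (a ≺ b)
  a ≺? b with ≺-dec a b
  ... | inj₁ p = yes p
  ... | inj₂ q = no λ p → ≺-irr (≺-⪯-trans p q)

  below : Fin n → Subset n
  below a = comprehension (_≺? a)

  ∣below∣<n : ∀ a → ∣ below a ∣ ℕ.< n
  ∣below∣<n a = subst (∣ below a ∣ ℕ.<_) (∣⊤∣≡n n)
    (p⊂q⇒∣p∣<∣q∣ {q = Subset.⊤}
      (⊆-max _ , a , ∈⊤ , λ a∈ → ≺-irr (∈-comprehension⁻ (_≺? a) a∈)))

  rank : Fin n → Fin n
  rank a = Fin.fromℕ< (∣below∣<n a)

  rank-mono : ∀ {a b} → a ≺ b → rank a Fin.< rank b
  rank-mono {a} {b} a≺b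
    rewrite Finₚ.toℕ-fromℕ< (∣below∣<n a) | Finₚ.toℕ-fromℕ< (∣below∣<n b) =
    p⊂q⇒∣p∣<∣q∣
      ( (λ c∈ → ∈-comprehension⁺ (_≺? b) (≺-trans (∈-comprehension⁻ (_≺? a) c∈) a≺b))
      , a , ∈-comprehension⁺ (_≺? b) a≺b , λ a∈ → ≺-irr (∈-comprehension⁻ (_≺? a) a∈))

  rank-reflect : ∀ {a b} → rank a Fin.< rank b → a ≺ b
  rank-reflect {a} {b} p with ≺-cmp a b
  ... | inj₁ q           = q
  ... | inj₂ (inj₁ refl) = contradiction p (ℕₚ.<-irrefl refl)
  ... | inj₂ (inj₂ q)    = contradiction p (ℕₚ.<-asym (rank-mono q))

  rank-injective : ∀ {a b} → rank a ≡ rank b → a ≡ b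
  rank-injective {a} {b} eq with ≺-cmp a b
  ... | inj₁ q        = contradiction (rank-mono q) (ℕₚ.<-irrefl (cong Fin.toℕ eq))
  ... | inj₂ (inj₁ q) = q
  ... | inj₂ (inj₂ q) = contradiction (rank-mono q) (ℕₚ.<-irrefl (cong Fin.toℕ (sym eq)))

  unrank : Fin n → Fin n
  unrank i = proj₁ (injective⇒surjective rank rank-injective i)

  rank-unrank : ∀ i → rank (unrank i) ≡ i
  rank-unrank i = proj₂ (injective⇒surjective rank rank-injective i)

  unrank-rank : ∀ a → unrank (rank a) ≡ a
  unrank-rank a = rank-injective (rank-unrank (rank a))

linear : (f : Fin n → ℕ) → (∀ {a b} → f a ≡ f b → a ≡ b) → Lin n
linear f inj = record
  { _≺_     = λ a b → f a ℕ.< f b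
  ; ≺-irr   = ℕₚ.<-irrefl refl
  ; ≺-trans = ℕₚ.<-trans
  ; ≺-cmp   = compare
  } where
  compare : ∀ a b → f a ℕ.< f b ⊎ a ≡ b ⊎ f b ℕ.< f a
  compare a b with ℕₚ.<-cmp (f a) (f b)
  ... | tri< p _ _ = inj₁ p
  ... | tri≈ _ p _ = inj₂ (inj₁ (inj p))
  ... | tri> _ _ p = inj₂ (inj₂ p)

plot : (α : Perm) → Conf (len α)
plot α = linear Fin.toℕ Finₚ.toℕ-injective , linear (Fin.toℕ ∘ val α) (inj α ∘ Finₚ.toℕ-injective)

module _ {P : Conf k} {C : Conf n} (e : Emb P C) where
  private
    module P = Conf P
    module C = Conf C

  emb-reflectˣ : ∀ {i j} → pt e i C.<ˣ pt e j → i P.<ˣ j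
  emb-reflectˣ {i} {j} p with P.cmpˣ i j
  ... | inj₁ q           = q
  ... | inj₂ (inj₁ refl) = contradiction p C.irrˣ
  ... | inj₂ (inj₂ q)    = contradiction p (C.asymˣ (monoˣ e q))

  emb-reflectʸ : ∀ {i j} → pt e i C.<ʸ pt e j → i P.<ʸ j
  emb-reflectʸ {i} {j} p with P.cmpʸ i j
  ... | inj₁ q           = q
  ... | inj₂ (inj₁ refl) = contradiction p C.irrʸ
  ... | inj₂ (inj₂ q)    = contradiction p (C.asymʸ (monoʸ e q))

≼⇒emb : ∀ α β → α ≼ β → Emb (plot α) (plot β)
≼⇒emb _ _ (e , mono , iff) = record
  { pt = e ; monoˣ = mono _ _ ; monoʸ = Equivalence.to (iff _ _) }

emb⇒≼ : ∀ α β → Emb (plot α) (plot β) → α ≼ β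
emb⇒≼ α β e = pt e , (λ i j → monoˣ e {i} {j}) ,
  λ i j → mk⇔ (monoʸ e {i} {j}) (emb-reflectʸ {P = plot α} {C = plot β} e {i} {j})

module _ (C : Conf n) where
  open Conf C
  private
    module RX = Rank X
    module RY = Rank Y

  standardise : Perm
  standardise = perm n (RY.rank ∘ RX.unrank) λ {i} {j} eq →
    trans (sym (RX.rank-unrank i))
      (trans (cong RX.rank (RY.rank-injective eq)) (RX.rank-unrank j))

  to-standard : Emb C (plot standardise)
  to-standard = record
    { pt    = RX.rank
    ; monoˣ = RX.rank-mono
    ; monoʸ = λ {a} {b} p →
        subst (ℕ._< _) (rank-value a) (subst (_ ℕ.<_) (rank-value b) (RY.rank-mono p))
    } where
    rank-value : ∀ a → Fin.toℕ (RY.rank a) ≡ Fin.toℕ (val standardise (RX.rank a))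
    rank-value a = cong (Fin.toℕ ∘ RY.rank) (sym (RX.unrank-rank a))

  from-standard : Emb (plot standardise) C
  from-standard = record
    { pt    = RX.unrank
    ; monoˣ = λ {i} {j} p → RX.rank-reflect
        (subst (ℕ._< _) (cong Fin.toℕ (sym (RX.rank-unrank i)))
          (subst (_ ℕ.<_) (cong Fin.toℕ (sym (RX.rank-unrank j))) p))
    ; monoʸ = RY.rank-reflect
    }

  -- An interval with `a` different from `b` pulls back along the horizontal ranks to a proper
  -- block.
  standardise-simple : (∀ S → ¬ ProperBlock C S) → Simple standardise
  standardise-simple no-block a b ((a≤b , b<n , closed) , not-all) with a ℕₚ.≟ b
  ... | yes a≡b = a≡b
  ... | no a≢b  = ⊥-elim (no-block S record
      { isBlock = convexˣ , convexʸ
      ; u∈ = at a a<n (ℕₚ.≤-refl , a≤b)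
      ; v∈ = at b b<n (a≤b , ℕₚ.≤-refl)
      ; u≢v = λ eq → a≢b (trans (sym (position-at a a<n))
          (trans (cong (Fin.toℕ ∘ RX.rank) eq) (position-at b b<n)))
      ; w∉ = proj₂ outside-S })
    where
    a<n = ℕₚ.≤-<-trans a≤b b<n
    In? : ∀ q → Dec (a ℕ.≤ Fin.toℕ (RX.rank q) × Fin.toℕ (RX.rank q) ℕ.≤ b)
    In? q = (a ℕₚ.≤? Fin.toℕ (RX.rank q)) ×-dec (Fin.toℕ (RX.rank q) ℕₚ.≤? b)
    S : Subset n
    S = comprehension In?
    point : ∀ c → c ℕ.< n → Fin n
    point c c<n = RX.unrank (Fin.fromℕ< c<n)
    position-at : ∀ c (c<n : c ℕ.< n) → Fin.toℕ (RX.rank (point c c<n)) ≡ c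
    position-at c c<n = trans (cong Fin.toℕ (RX.rank-unrank _)) (Finₚ.toℕ-fromℕ< c<n)
    at : ∀ c (c<n : c ℕ.< n) → a ℕ.≤ c × c ℕ.≤ b → point c c<n ∈ S
    at c c<n p = ∈-comprehension⁺ In?
      (subst (λ c → a ℕ.≤ c × c ℕ.≤ b) (sym (position-at c c<n)) p)
    at⁻ : ∀ c (c<n : c ℕ.< n) → point c c<n ∈ S → a ℕ.≤ c × c ℕ.≤ b
    at⁻ c c<n p =
      subst (λ c → a ℕ.≤ c × c ℕ.≤ b) (position-at c c<n) (∈-comprehension⁻ In? p)
    convexˣ : Convex X S
    convexˣ p∈ r∈ p q = ∈-comprehension⁺ In?
      ( ℕₚ.≤-trans (proj₁ (∈-comprehension⁻ In? p∈)) (ℕₚ.<⇒≤ (RX.rank-mono p))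
      , ℕₚ.≤-trans (ℕₚ.<⇒≤ (RX.rank-mono q)) (proj₂ (∈-comprehension⁻ In? r∈)))
    convexʸ : Convex Y S
    convexʸ {p} {q} {r} p∈ r∈ p<q q<r = ∈-comprehension⁺ In?
      (closed (RX.rank p) (RX.rank r) (RX.rank q)
        (proj₁ (∈-comprehension⁻ In? p∈)) (proj₂ (∈-comprehension⁻ In? p∈))
        (proj₁ (∈-comprehension⁻ In? r∈)) (proj₂ (∈-comprehension⁻ In? r∈))
        (ℕₚ.<⇒≤ (monoʸ to-standard p<q)) (ℕₚ.<⇒≤ (monoʸ to-standard q<r)))
    outside-S : ∃ (_∉ S)
    -- Position 0 is outside unless `a` is 0; then `suc b` is still a position, as the interval is
    -- not everything.
    outside-S with a ℕₚ.≟ 0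
    ... | no a≢0 = point 0 0<n , λ ∈S → a≢0 (ℕₚ.n≤0⇒n≡0 (proj₁ (at⁻ 0 0<n ∈S)))
      where 0<n = ℕₚ.≤-<-trans ℕ.z≤n b<n
    ... | yes a≡0 = point (suc b) 1+b<n , λ ∈S → ℕₚ.1+n≰n (proj₂ (at⁻ (suc b) 1+b<n ∈S))
      where 1+b<n = ℕₚ.≤∧≢⇒< b<n λ eq → not-all (a≡0 , eq)

-- Direct sums of configurations.

record Decomposition (A : Conf k) (B : Conf l) (C : Conf n) : Set where
  open Conf C
  field
    inl   : Emb A C
    inr   : Emb B C
    cross : ∀ i j → pt inl i ↗ pt inr j
    cover : ∀ q → (∃ λ i → q ≡ pt inl i) ⊎ (∃ λ j → q ≡ pt inr j)

directSum⇒decomposition : ∀ {α β γ} →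
  IsDirectSum α β γ → Decomposition (plot α) (plot β) (plot γ)
directSum⇒decomposition {α} {β} {γ} (refl , valˡ , valʳ) = record
  { inl   = record { pt    = _↑ˡ len β
                   ; monoˣ = λ {i} {j} → lt-↑ˡ i j
                   ; monoʸ = λ {i} {j} p → val-↑ˡ i j p }
  ; inr   = record { pt    = len α ↑ʳ_
                   ; monoˣ = λ {i} {j} → lt-↑ʳ i j
                   ; monoʸ = λ {i} {j} p → val-↑ʳ i j p }
  ; cross = λ i j → lt-cross i j , val-cross i j
  ; cover = ↑ˡ-or-↑ʳ
  } where
  lt-↑ˡ : ∀ i j → i Fin.< j → (i ↑ˡ len β) Fin.< (j ↑ˡ len β)
  lt-↑ˡ i j p rewrite Finₚ.toℕ-↑ˡ i (len β) | Finₚ.toℕ-↑ˡ j (len β) = p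
  lt-↑ʳ : ∀ i j → i Fin.< j → (len α ↑ʳ i) Fin.< (len α ↑ʳ j)
  lt-↑ʳ i j p rewrite Finₚ.toℕ-↑ʳ (len α) i | Finₚ.toℕ-↑ʳ (len α) j = ℕₚ.+-monoʳ-< (len α) p
  lt-cross : ∀ i j → (i ↑ˡ len β) Fin.< (len α ↑ʳ j)
  lt-cross i j rewrite Finₚ.toℕ-↑ˡ i (len β) | Finₚ.toℕ-↑ʳ (len α) j =
    ℕₚ.<-≤-trans (Finₚ.toℕ<n i) (ℕₚ.m≤m+n (len α) (Fin.toℕ j))
  val-↑ˡ : ∀ i j → val α i Fin.< val α j → val γ (i ↑ˡ len β) Fin.< val γ (j ↑ˡ len β)
  val-↑ˡ i j p rewrite valˡ i | valˡ j = lt-↑ˡ (val α i) (val α j) p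
  val-↑ʳ : ∀ i j → val β i Fin.< val β j → val γ (len α ↑ʳ i) Fin.< val γ (len α ↑ʳ j)
  val-↑ʳ i j p rewrite valʳ i | valʳ j = lt-↑ʳ (val β i) (val β j) p
  val-cross : ∀ i j → val γ (i ↑ˡ len β) Fin.< val γ (len α ↑ʳ j)
  val-cross i j rewrite valˡ i | valʳ j = lt-cross (val α i) (val β j)
  ↑ˡ-or-↑ʳ : ∀ q → (∃ λ i → q ≡ i ↑ˡ len β) ⊎ (∃ λ j → q ≡ len α ↑ʳ j)
  ↑ˡ-or-↑ʳ q with position (len α) q
  ... | left i  = inj₁ (i , refl)
  ... | right j = inj₂ (j , refl)

module _ {A : Conf k} {B : Conf l} {S : Conf m} (sum : Decomposition A B S) {C : Conf n}
         (e : Emb A C) (f : Emb B C) (e↗f : ∀ i j → Conf._↗_ C (pt e i) (pt f j)) where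
  open Conf C
  open Decomposition sum
  private module S = Conf S

  -- The origin of each point is kept beside it, so that monotonicity can be proved by cases on both
  -- arguments.
  glue-pt : ∀ q → ∃ λ p →
    (∃ λ i → q ≡ pt inl i × p ≡ pt e i) ⊎ (∃ λ j → q ≡ pt inr j × p ≡ pt f j)
  glue-pt q with cover q
  ... | inj₁ (i , eq) = pt e i , inj₁ (i , eq , refl)
  ... | inj₂ (j , eq) = pt f j , inj₂ (j , eq , refl)

  glue : Emb S C
  glue = record { pt = proj₁ ∘ glue-pt ; monoˣ = λ {p} {q} → mx p q ; monoʸ = λ {p} {q} → my p q }
    where
    mx : ∀ p q → p S.<ˣ q → proj₁ (glue-pt p) <ˣ proj₁ (glue-pt q)
    mx p q p<q with glue-pt p | glue-pt q
    ... | _ , inj₁ (i , refl , refl) | _ , inj₁ (j , refl , refl) = monoˣ e (emb-reflectˣ inl p<q)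
    ... | _ , inj₁ (i , refl , refl) | _ , inj₂ (j , refl , refl) = proj₁ (e↗f i j)
    ... | _ , inj₂ (i , refl , refl) | _ , inj₁ (j , refl , refl) =
      contradiction p<q (S.asymˣ (proj₁ (cross j i)))
    ... | _ , inj₂ (i , refl , refl) | _ , inj₂ (j , refl , refl) = monoˣ f (emb-reflectˣ inr p<q)
    my : ∀ p q → p S.<ʸ q → proj₁ (glue-pt p) <ʸ proj₁ (glue-pt q)
    my p q p<q with glue-pt p | glue-pt q
    ... | _ , inj₁ (i , refl , refl) | _ , inj₁ (j , refl , refl) = monoʸ e (emb-reflectʸ inl p<q)
    ... | _ , inj₁ (i , refl , refl) | _ , inj₂ (j , refl , refl) = proj₂ (e↗f i j)
    ... | _ , inj₂ (i , refl , refl) | _ , inj₁ (j , refl , refl) =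
      contradiction p<q (S.asymʸ (proj₂ (cross j i)))
    ... | _ , inj₂ (i , refl , refl) | _ , inj₂ (j , refl , refl) = monoʸ f (emb-reflectʸ inr p<q)

  glue-↗ : {D : Conf o} (g : Emb D C) → Fin l → (∀ i j → pt f i ↗ pt g j) →
           ∀ i j → pt glue i ↗ pt g j
  glue-↗ g j₀ f↗g i j with glue-pt i
  ... | _ , inj₁ (i′ , _ , refl) = ↗-trans (e↗f i′ j₀) (f↗g j₀ j)
  ... | _ , inj₂ (i′ , _ , refl) = f↗g i′ j

emb-↗ : {P : Conf k} {C : Conf n} (e : Emb P C) →
  ∀ {i j} → Conf._↗_ P i j → Conf._↗_ C (pt e i) (pt e j)
emb-↗ e (p , q) = monoˣ e p , monoʸ e q

nonempty : n ≢ 0 → Fin n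
nonempty {zero}  n≢0 = contradiction refl n≢0
nonempty {suc n} _   = zero

-- The class avoiding a sum of three is not deflatable.

theorem3p1 : ∀ (π λ' μ ρ : Perm) →
    ¬ (len λ' ≡ 0) → ¬ (len μ ≡ 0) → ¬ (len ρ ≡ 0) →
    (Σ Perm λ τ → IsDirectSum λ' μ τ × IsDirectSum τ ρ π) →
    ¬ Deflatable (Av π)
theorem3p1 π λ' μ ρ λ≢ μ≢ ρ≢ (τ , sumτ , sumπ)
           (D , D-class , _ , (σ , σ-avoids , σ∉D) , closed) =
  simple-extension {Λ = plot λ'} {plot μ} {plot ρ}
    (nonempty λ≢) μ₀ (nonempty ρ≢) {plot σ} no-simple
    (record { pt = id ; monoˣ = id ; monoʸ = id })
    -- The three copies glue to a copy of `π` in `σ`, first across `τ` and then across `π`.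
    λ e f g p q → σ-avoids (emb⇒≼ π σ (glue T (glue S e f p) g (glue-↗ S e f p g μ₀ q)))
  where
  μ₀ = nonempty μ≢
  S = directSum⇒decomposition {λ'} {μ} {τ} sumτ
  T = directSum⇒decomposition {τ} {ρ} {π} sumπ
  module S = Decomposition S
  module T = Decomposition T
  -- A simple member of `Av π` lies in the closure of `D`, hence in `D`. Being a class, `D` would
  -- then contain `σ` as well.
  no-simple : ∀ {n} (C : Conf n) → Emb (plot σ) C → Avoids (plot λ') (plot μ) (plot ρ) C →
              ¬ (∀ S → ¬ ProperBlock C S)
  no-simple C emb avoid no-block =
    σ∉D (D-class σ (standardise C) (emb⇒≼ σ (standardise C) (to-standard C ∘ᵉ emb)) in-D)
    where
    in-Av : Av π (standardise C)
    in-Av π≼ = avoid (h ∘ᵉ (T.inl ∘ᵉ S.inl)) (h ∘ᵉ (T.inl ∘ᵉ S.inr)) (h ∘ᵉ T.inr)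
      (λ i j → emb-↗ h (emb-↗ T.inl (S.cross i j))) (λ i j → emb-↗ h (T.cross (pt S.inr i) j))
      where
      h : Emb (plot π) C
      h = from-standard C ∘ᵉ ≼⇒emb π (standardise C) π≼
    in-D : D (standardise C)
    in-D with closed (standardise C) in-Av
    ... | E , _ , same-simples , in-E =
      Equivalence.to (same-simples (standardise C) (standardise-simple C no-block)) in-E
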